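{- Let $i\ge 0$ and let $K$ be an $(i+1)$-path connected finite simplicial complex. Then the following are equivalent: (1) the $i$-th signed incidence graph $B_i(K)$ (with respect to any orientation of $K$) is balanced; (2) $K$ contains no $(i+1)$-orientable circuit of odd length and no $(i+1)$-non-orientable circuit of even length.
   Context: A simplicial complex $K$ is a finite collection of subsets of a vertex set closed under taking subsets; an $i$-face has $i+1$ elements, $S_i(K)$ is the set of $i$-faces. An orientation assigns each face an ordering of its vertices up to even permutations. For an oriented $(i+1)$-face $[\bar F]=[v_0,\dots,v_{i+1}]$ and $F=\bar F\setminus\{v_j\}$, $\operatorname{sgn}([F],\partial[\bar F])=(-1)^j$ if the orientation of $F$ agrees with $[v_0,\dots,\hat v_j,\dots,v_{i+1}]$, and $-(-1)^j$ otherwise. The $i$-th signed incidence graph $B_i(K)$ is the bipartite graph on $S_i(K)\cup S_{i+1}(K)$ with an edge $\{F,\bar F\}$ iff $F\subset\bar F$, signed by $\operatorname{sgn}([F],\partial[\bar F])$; it is balanced if every cycle has positive product of signs (this does not depend on the orientation chosen). An $(i+1)$-path of length $m$ is a sequence of $(i+1)$-faces $\bar F_1,\dots,\bar F_m$ such that $\bar F_j\cap\bar F_l$ is an $i$-face if and only if $|j-l|=1$; $K$ is $(i+1)$-path connected if any two $(i+1)$-faces are joined by an $(i+1)$-path. When $\bar F_m$ coincides with $\bar F_1$, the sequence is called an $(i+1)$-circuit of length $m-1$ (consecutive faces, cyclically, share an $i$-face). A pure $(i+1)$-dimensional complex is orientable if one can orient all its $(i+1)$-faces so that any two $(i+1)$-faces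 meeting in an $i$-face induce opposite orientations on that $i$-face; an $(i+1)$-circuit is called orientable or non-orientable according to whether the pure $(i+1)$-dimensional complex formed by its faces is orientable in this sense. -}

module Defs where

open import Data.Nat using (ℕ; zero; suc; _≤_; _<ᵇ_; _≡ᵇ_; _%_; ∣_-_∣)
open import Data.Nat.Properties using (_≟_)
open import Data.Bool using (if_then_else_)
open import Data.List using (List; []; _∷_; length; filter; zip; _++_; lookup; foldr)
open import Data.List.Membership.Propositional using (_∈_)
open import Data.List.Membership.DecPropositional _≟_ using (_∈?_)
open import Data.List.Relation.Unary.All using (All)
open import Data.List.Relation.Unary.Linked using (Linked)
open import Data.List.Relation.Unary.Unique.Propositional using (Unique)
open import Data.List.Relation.Binary.Sublist.Propositional using (_⊆_)
open import Data.Fin using (Fin; toℕ)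
open import Data.Product using (Σ; ∃; _×_; _,_; proj₁; proj₂)
open import Data.Sum using (_⊎_)
open import Data.Sign using (Sign; opposite) renaming (_*_ to _·_)
import Data.Sign as S
open import Function.Bundles using (_⇔_)
open import Relation.Nullary using (¬_)
open import Relation.Binary.PropositionalEquality using (_≡_; _≢_)
import Data.Nat as N

------------------------------------------------------------------------
-- Simplicial complexes on vertex set ℕ.
-- A face is stored canonically as the strictly increasing list of its
-- vertices; an i-face is a face with i+1 vertices.

Face : Set
Face = List ℕ

record SimplicialComplex : Set where
  field
    faces        : List Face
    facesSorted  : All (Linked N._<_) faces
    -- closed under taking subsets (sub-lists of a strictly increasing
    -- list are exactly its subsets)
    downClosed   : ∀ {σ τ} → σ ∈ faces → τ ⊆ σ → τ ∈ faces
open SimplicialComplex public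

-- F is an i-face of K  (F ∈ S_i(K))
IsFace : SimplicialComplex → ℕ → Face → Set
IsFace K i F = (F ∈ faces K) × (length F ≡ suc i)

-- intersection of two faces (as a strictly increasing list)
_∩_ : Face → Face → Face
A ∩ B = filter (_∈? B) A

-- A ∩ B is an i-face  (it is automatically a face of K by closure)
MeetInIFace : ℕ → Face → Face → Set
MeetInIFace i A B = length (A ∩ B) ≡ suc i

------------------------------------------------------------------------
-- Orientations.  An ordering of a face up to even permutations is
-- encoded by a sign relative to the increasing ordering: + means the
-- class of the increasing ordering, - the other class.  Faces with at
-- most one vertex have a single ordering, so their sign is forced to +.

record Orientation : Set where
  field
    ori     : Face → Sign
    trivial : ∀ F → length F ≤ 1 → ori F ≡ S.+
open Orientation public

-- (-1)^j
signPow : ℕ → Sign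
signPow zero    = S.+
signPow (suc j) = opposite (signPow j)

-- position j (in increasing order of F̄) of the vertex v_j with F = F̄ \ {v_j}
removedIndex : Face → Face → ℕ
removedIndex []       _        = 0
removedIndex (x ∷ xs) []       = 0
removedIndex (x ∷ xs) (y ∷ ys) = if x ≡ᵇ y then suc (removedIndex xs ys) else 0

-- sgn([F], ∂[F̄]) : with [F̄] = ori F̄ · [v_0,…,v_{i+1}] (increasing),
-- the face [v_0,…,v̂_j,…,v_{i+1}] is the increasing ordering of F.
sgn : Orientation → Face → Face → Sign
sgn o F F̄ = signPow (removedIndex F F̄) · (ori o F̄ · ori o F)

------------------------------------------------------------------------
-- The i-th signed incidence graph B_i(K) and balance.

-- F ⊂ F̄ with F an i-face and F̄ an (i+1)-face of K
Incidence : SimplicialComplex → ℕ → Face → Face → Set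
Incidence K i F F̄ = IsFace K i F × IsFace K (suc i) F̄ × All (_∈ F̄) F

-- (undirected) adjacency in B_i(K)
Adj : SimplicialComplex → ℕ → Face → Face → Set
Adj K i u v = Incidence K i u v ⊎ Incidence K i v u

-- the sign of the edge {u,v} of B_i(K)
edgeSign : Orientation → Face → Face → Sign
edgeSign o u v = if length u <ᵇ length v then sgn o u v else sgn o v u

-- consecutive pairs of a cyclic sequence v₀ … v_{k-1} (including (v_{k-1}, v₀))
cyclicPairs : List Face → List (Face × Face)
cyclicPairs []       = []
cyclicPairs (v ∷ vs) = zip (v ∷ vs) (vs ++ v ∷ [])

-- a cycle of B_i(K): k ≥ 3 distinct vertices, cyclically consecutive ones adjacent
IsCycle : SimplicialComplex → ℕ → List Face → Set
IsCycle K i vs = (3 ≤ length vs) × Unique vs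
               × All (λ e → Adj K i (proj₁ e) (proj₂ e)) (cyclicPairs vs)

cycleSign : Orientation → List Face → Sign
cycleSign o vs = foldr (λ e s → edgeSign o (proj₁ e) (proj₂ e) · s) S.+ (cyclicPairs vs)

-- B_i(K) is balanced: every cycle has positive product of signs
Balanced : SimplicialComplex → ℕ → Orientation → Set
Balanced K i o = ∀ vs → IsCycle K i vs → cycleSign o vs ≡ S.+

------------------------------------------------------------------------
-- (i+1)-paths, path connectedness, circuits, orientability.

-- F̄_1,…,F̄_m (i+1)-faces with F̄_j ∩ F̄_l an i-face iff |j - l| = 1
IsPath : SimplicialComplex → ℕ → List Face → Set
IsPath K i ps = All (IsFace K (suc i)) ps
  × (∀ (j l : Fin (length ps)) →
       MeetInIFace i (lookup ps j) (lookup ps l) ⇔ (∣ toℕ j - toℕ l ∣ ≡ 1))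

lastOf : Face → List Face → Face
lastOf x []       = x
lastOf x (y ∷ ys) = lastOf y ys

PathConnected : SimplicialComplex → ℕ → Set
PathConnected K i = ∀ A B → IsFace K (suc i) A → IsFace K (suc i) B →
  ∃ λ ps → IsPath K i (A ∷ ps) × lastOf A ps ≡ B

-- j and l are adjacent modulo n (indices 0,…,n-1 arranged in a cycle)
CyclicAdj : (n : ℕ) → Fin n → Fin n → Set
CyclicAdj n j l = (toℕ l ≡ suc (toℕ j)) ⊎ (toℕ j ≡ suc (toℕ l))
                ⊎ ((toℕ j ≡ 0) × (suc (toℕ l) ≡ n))
                ⊎ ((toℕ l ≡ 0) × (suc (toℕ j) ≡ n))

-- an (i+1)-circuit of length n: the list F̄_1,…,F̄_n (F̄_{n+1} = F̄_1),
-- with F̄_j ∩ F̄_l an i-face iff j, l are cyclically consecutive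
IsCircuit : SimplicialComplex → ℕ → List Face → Set
IsCircuit K i cs = All (IsFace K (suc i)) cs
  × (∀ (j l : Fin (length cs)) →
       MeetInIFace i (lookup cs j) (lookup cs l) ⇔ CyclicAdj (length cs) j l)

-- orientation sign induced on the i-face G by the (i+1)-face F̄ oriented by ε
induced : (Face → Sign) → Face → Face → Sign
induced ε F̄ G = signPow (removedIndex G F̄) · ε F̄

-- the pure (i+1)-dimensional complex whose (i+1)-faces are those in cs
-- is orientable: orient them so that any two distinct ones meeting in
-- an i-face induce opposite orientations on it
Orientable : ℕ → List Face → Set
Orientable i cs = Σ (Face → Sign) λ ε →
  ∀ {A B} → A ∈ cs → B ∈ cs → A ≢ B → MeetInIFace i A B →
    induced ε A (A ∩ B) ≡ opposite (induced ε B (A ∩ B))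

Odd Even : ℕ → Set
Odd n  = n % 2 ≡ 1
Even n = n % 2 ≡ 0

-- K has no orientable (i+1)-circuit of odd length and no
-- non-orientable (i+1)-circuit of even length
NoBadCircuits : SimplicialComplex → ℕ → Set
NoBadCircuits K i =
    ¬ (∃ λ cs → IsCircuit K i cs × Orientable i cs × Odd (length cs))
  × ¬ (∃ λ cs → IsCircuit K i cs × ¬ Orientable i cs × Even (length cs))

module Submission where

-- A closed walk in B_i through an (i+1)-face alternates between (i+1)-faces and the i-faces they
-- share, so it is a closed walk A₀ ~ A₁ ~ ⋯ in the dual graph of the (i+1)-faces, whose sign is the
-- product of the signs dualSign Aⱼ Aⱼ₊₁ of the paths Aⱼ, Aⱼ ∩ Aⱼ₊₁, Aⱼ₊₁.  Since a negative closed
-- walk contains a negative cycle, B_i is balanced iff every closed dual walk is positive.  A chord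
-- splits a closed dual walk into two shorter ones whose signs multiply to its sign, so it suffices
-- that every circuit (chordless closed dual walk) is positive.  Finally a circuit is orientable iff
-- its sign is (-1)^length: writing an orientation as ε = δ · ori, compatibility along A ~ B says
-- dualSign A B = - δ A · δ B, which telescopes around the circuit; conversely the signs of the
-- initial segments of a circuit of sign (-1)^length define such a δ.  So all circuits are positive
-- iff orientable circuits have even length and non-orientable ones odd length.

open import Defs
import Data.Nat.Properties as ℕ
open import Algebra.Properties.CommutativeSemigroup using (interchange)
open import Data.Bool using (true; false)
open import Data.Empty using (⊥-elim)
open import Data.Fin using (Fin; zero; suc; toℕ; fromℕ)
open import Data.Fin.Properties using (toℕ-fromℕ; toℕ-injective; any?)
open import Data.List using (List; []; _∷_; length; _++_; zip; foldr; lookup)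
open import Data.List.Membership.DecPropositional ℕ._≟_ using (_∈?_)
open import Data.List.Membership.Propositional using (_∈_)
open import Data.List.Membership.Propositional.Properties using (∈-∃++; ∈-filter⁺; ∈-filter⁻; ∈-lookup)
open import Data.List.Properties using (++-assoc; length-++; ≡-dec; filter-all; filter-notAll)
open import Data.List.Relation.Binary.Pointwise using (Pointwise-≡⇒≡)
open import Data.List.Relation.Binary.Sublist.Heterogeneous.Properties using (toPointwise)
open import Data.List.Relation.Binary.Sublist.Propositional using (_⊆_; _∷_; _∷ʳ_; minimum; ⊆-antisym)
open import Data.List.Relation.Binary.Sublist.Propositional.Properties using (length-mono-≤; filter-⊆)
open import Data.List.Relation.Unary.All using (All; []; _∷_)
import Data.List.Relation.Unary.All as All
open import Data.List.Relation.Unary.All.Properties.Core using (¬Any⇒All¬; ¬All⇒Any¬)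
open import Data.List.Relation.Unary.AllPairs using (AllPairs; []; _∷_)
import Data.List.Relation.Unary.AllPairs.Properties as AllPairs
open import Data.List.Relation.Unary.Any using (here; there; index)
import Data.List.Relation.Unary.Any as Any
open import Data.List.Relation.Unary.Any.Properties using (lookup-index)
open import Data.List.Relation.Unary.Linked using (Linked; []; [-]; _∷_)
open import Data.List.Relation.Unary.Linked.Properties using (Linked⇒AllPairs)
open import Data.List.Relation.Unary.Unique.Propositional using (Unique)
open import Data.Nat using (ℕ; zero; suc; _+_; _≤_; _<_; s≤s; z≤n; _<ᵇ_)
open import Data.Nat.Induction using (<-wellFounded)
open import Data.Nat.Tactic.RingSolver using (solve-∀)
open import Data.Product using (∃; _×_; _,_; proj₁; proj₂; uncurry)
open import Data.Sign using (Sign; opposite) renaming (_*_ to _·_)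
import Data.Sign as S
open import Data.Sign.Properties
  using (*-cancelʳ-≡; *-comm; *-assoc; *-identityʳ; s*s≡+; opposite[s]*s≡-; opposite-involutive
        ; *-commutativeSemigroup)
open import Data.Sum using (_⊎_; inj₁; inj₂; [_,_]′)
open import Function using (_∘_; id; case_of_)
open import Function.Bundles using (_⇔_; mk⇔; Equivalence)
open import Function.Properties.Equivalence using () renaming (trans to ⇔-trans)
open import Induction.WellFounded using (Acc; acc)
open import Relation.Binary.Definitions using (tri<; tri≈; tri>)
open import Relation.Binary.PropositionalEquality
open import Relation.Nullary using (¬_; Dec; yes; no)
open import Relation.Nullary.Decidable using (_⊎-dec_; _×-dec_; ¬?; decidable-stable)

-- Signs

+≢- : S.+ ≢ S.-
+≢- ()

≢-⇒≡+ : ∀ {s} → s ≢ S.- → s ≡ S.+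
≢-⇒≡+ {S.+} _   = refl
≢-⇒≡+ {S.-} s≢- = ⊥-elim (s≢- refl)

·≡-⇒≡-⊎≡- : ∀ a b → a · b ≡ S.- → a ≡ S.- ⊎ b ≡ S.-
·≡-⇒≡-⊎≡- S.- b _  = inj₁ refl
·≡-⇒≡-⊎≡- S.+ b eq = inj₂ eq

≡opposite⇒·≡- : ∀ {a b} → a ≡ opposite b → a · b ≡ S.-
≡opposite⇒·≡- {b = b} refl = opposite[s]*s≡- b

·≡-⇒≡opposite : ∀ {a b} → a · b ≡ S.- → a ≡ opposite b
·≡-⇒≡opposite {S.+} {S.-} _ = refl
·≡-⇒≡opposite {S.-} {S.+} _ = refl

≡opposite⇔opposite≡ : ∀ {a b} → a ≡ opposite b ⇔ opposite a ≡ b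
≡opposite⇔opposite≡ {a} {b} = mk⇔ (λ eq → trans (cong opposite eq) (opposite-involutive b))
                                  (λ eq → trans (sym (opposite-involutive a)) (cong opposite eq))

opposite-swap : ∀ a b x y → a · x ≡ opposite (b · y) → a · b ≡ opposite (x · y)
opposite-swap a b x y eq =
  ·≡-⇒≡opposite (trans (interchange *-commutativeSemigroup a b x y) (≡opposite⇒·≡- eq))

·≡+⇔≡ : ∀ a b → a · b ≡ S.+ ⇔ a ≡ b
·≡+⇔≡ a b = mk⇔ (λ eq → *-cancelʳ-≡ b a b (trans eq (sym (s*s≡+ b)))) (λ { refl → s*s≡+ a })

·≡+-common : ∀ a b u → a · u ≡ S.+ → b · u ≡ S.+ → a · b ≡ S.+
·≡+-common a b u au bu = Equivalence.from (·≡+⇔≡ a b) (trans a≡u (sym b≡u))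
  where
  a≡u = Equivalence.to (·≡+⇔≡ a u) au
  b≡u = Equivalence.to (·≡+⇔≡ b u) bu

·-cancelˡ : ∀ a b → a · (a · b) ≡ b
·-cancelˡ a b = trans (sym (*-assoc a a b)) (cong (_· b) (s*s≡+ a))

·-telescope : ∀ a b c → (a · b) · (b · c) ≡ a · c
·-telescope a b c = trans (*-assoc a b (b · c)) (cong (a ·_) (·-cancelˡ b c))

-- k % 2 and (2 + k) % 2 are definitionally equal.
signPow-parity : ∀ k → (Even k × signPow k ≡ S.+) ⊎ (Odd k × signPow k ≡ S.-)
signPow-parity zero          = inj₁ (refl , refl)
signPow-parity (suc zero)    = inj₂ (refl , refl)
signPow-parity (suc (suc k)) with signPow-parity k
... | inj₁ (even , eq) = inj₁ (even , cong (opposite ∘ opposite) eq)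
... | inj₂ (odd  , eq) = inj₂ (odd  , cong (opposite ∘ opposite) eq)

0≢1 : 0 ≢ 1
0≢1 ()

-- Positions in lists

nonempty-++ : ∀ {A : Set} (xs ys : List A) → 0 < length ys → 0 < length (xs ++ ys)
nonempty-++ xs ys 0<ys rewrite length-++ xs {ys} = ℕ.<-≤-trans 0<ys (ℕ.m≤n+m _ (length xs))

CyclicAdj-elim : ∀ {n} (P : Fin n → Fin n → Set) → (∀ {j l} → P j l → P l j) →
                 (∀ j l → toℕ l ≡ suc (toℕ j) → P j l) →
                 (∀ j l → suc (toℕ j) ≡ n → toℕ l ≡ 0 → P j l) →
                 ∀ j l → CyclicAdj n j l → P j l
CyclicAdj-elim P sym step wrap j l (inj₁ l≡1+j)                    = step j l l≡1+j
CyclicAdj-elim P sym step wrap j l (inj₂ (inj₁ j≡1+l))             = sym (step l j j≡1+l)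
CyclicAdj-elim P sym step wrap j l (inj₂ (inj₂ (inj₁ (j≡0 , l≡n)))) = sym (wrap l j l≡n j≡0)
CyclicAdj-elim P sym step wrap j l (inj₂ (inj₂ (inj₂ (l≡0 , j≡n)))) = wrap j l j≡n l≡0

CyclicAdj-sym : ∀ {n j l} → CyclicAdj n j l → CyclicAdj n l j
CyclicAdj-sym (inj₁ e)               = inj₂ (inj₁ e)
CyclicAdj-sym (inj₂ (inj₁ e))        = inj₁ e
CyclicAdj-sym (inj₂ (inj₂ (inj₁ e))) = inj₂ (inj₂ (inj₂ e))
CyclicAdj-sym (inj₂ (inj₂ (inj₂ e))) = inj₂ (inj₂ (inj₁ e))

CyclicAdj? : ∀ n (j l : Fin n) → Dec (CyclicAdj n j l)
CyclicAdj? n j l = toℕ l ℕ.≟ suc (toℕ j)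
           ⊎-dec toℕ j ℕ.≟ suc (toℕ l)
           ⊎-dec (toℕ j ℕ.≟ 0 ×-dec suc (toℕ l) ℕ.≟ n)
           ⊎-dec (toℕ l ℕ.≟ 0 ×-dec suc (toℕ j) ℕ.≟ n)

split-at : ∀ {A : Set} (ys : List A) (l : Fin (length ys)) →
           ∃ λ qs → ∃ λ rs → ys ≡ qs ++ lookup ys l ∷ rs × toℕ l ≡ length qs
split-at (y ∷ ys) zero    = [] , ys , refl , refl
split-at (y ∷ ys) (suc l) with split-at ys l
... | qs , rs , eq , |qs| = y ∷ qs , rs , cong (y ∷_) eq , cong suc |qs|

split-at₂ : ∀ {A : Set} (ys : List A) (j l : Fin (length ys)) → toℕ j < toℕ l →
            ∃ λ ps → ∃ λ a → ∃ λ qs → ∃ λ b → ∃ λ rs →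
              ys ≡ ps ++ a ∷ qs ++ b ∷ rs × lookup ys j ≡ a × lookup ys l ≡ b
              × length ps ≡ toℕ j × toℕ l ≡ length ps + suc (length qs)
split-at₂ (y ∷ ys) zero (suc l) _ with split-at ys l
... | qs , rs , eq , |qs| = [] , y , qs , lookup ys l , rs , cong (y ∷_) eq , refl , refl , refl , cong suc |qs|
split-at₂ (y ∷ ys) (suc j) (suc l) (s≤s j<l) with split-at₂ ys j l j<l
... | ps , a , qs , b , rs , eq , ja , lb , |ps| , l≡ =
  y ∷ ps , a , qs , b , rs , cong (y ∷_) eq , ja , lb , cong suc |ps| , cong suc l≡

-- Two non-adjacent positions j < l leave at least one position strictly between them on either side.
chord-arc₁ : ∀ {A : Set} {j l} (ps qs : List A) b → length ps ≡ j → l ≡ length ps + suc (length qs) →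
             l ≢ suc j → 1 < length (qs ++ b ∷ [])
chord-arc₁ ps []       b refl refl l≢1+j = ⊥-elim (l≢1+j (ℕ.+-comm (length ps) 1))
chord-arc₁ ps (q ∷ qs) b _    _    _     = s≤s (nonempty-++ qs (b ∷ []) (s≤s z≤n))

chord-arc₂ : ∀ {A : Set} {j l n} (ps : List A) a qs b rs → length ps ≡ j → l ≡ length ps + suc (length qs) →
             n ≡ length (ps ++ a ∷ qs ++ b ∷ rs) → ¬ (j ≡ 0 × suc l ≡ n) → 1 < length (rs ++ ps ++ a ∷ [])
chord-arc₂ []       a qs b []       refl refl refl ¬wrap =
  ⊥-elim (¬wrap (refl , cong suc (sym (trans (length-++ qs) (ℕ.+-comm (length qs) 1)))))
chord-arc₂ (p ∷ ps) a qs b []       _    _    _    _     = s≤s (nonempty-++ ps (a ∷ []) (s≤s z≤n))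
chord-arc₂ ps       a qs b (r ∷ rs) _    _    _    _     =
  s≤s (nonempty-++ rs (ps ++ a ∷ []) (nonempty-++ ps (a ∷ []) (s≤s z≤n)))

lookup-lastOf : ∀ x ys (j : Fin (length ys)) → suc (toℕ j) ≡ length ys → lookup ys j ≡ lastOf x ys
lookup-lastOf x (y ∷ [])     zero    _ = refl
lookup-lastOf x (y ∷ z ∷ ys) zero    ()
lookup-lastOf x (y ∷ ys)     (suc j) e = lookup-lastOf y ys j (ℕ.suc-injective e)

-- Walks: x ∷ ys is a walk from x, closed when it ends at x again

walkSign : (Face → Face → Sign) → Face → List Face → Sign
walkSign f x []       = S.+
walkSign f x (y ∷ ys) = f x y · walkSign f y ys

ClosedWalk : (Face → Face → Set) → Face → List Face → Set
ClosedWalk R x ys = Linked R (x ∷ ys) × lastOf x ys ≡ x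

lastOf-++ : ∀ x ys zs → lastOf x (ys ++ zs) ≡ lastOf (lastOf x ys) zs
lastOf-++ x []       zs = refl
lastOf-++ x (y ∷ ys) zs = lastOf-++ y ys zs

lastOf-snoc : ∀ x ys z → lastOf x (ys ++ z ∷ []) ≡ z
lastOf-snoc x ys z = lastOf-++ x ys (z ∷ [])

lastOf-∈ : ∀ x y ys → lastOf x (y ∷ ys) ∈ y ∷ ys
lastOf-∈ x y []       = here refl
lastOf-∈ x y (z ∷ ys) = there (lastOf-∈ y z ys)

walkSign-++ : ∀ f x ys zs → walkSign f x (ys ++ zs) ≡ walkSign f x ys · walkSign f (lastOf x ys) zs
walkSign-++ f x []       zs = refl
walkSign-++ f x (y ∷ ys) zs =
  trans (cong (f x y ·_) (walkSign-++ f y ys zs)) (sym (*-assoc (f x y) _ _))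

walkSign-rotate : ∀ f x ys zs → lastOf x (ys ++ zs) ≡ x →
                  walkSign f x (ys ++ zs) ≡ walkSign f (lastOf x ys) (zs ++ ys)
walkSign-rotate f x ys zs closed = begin
  walkSign f x (ys ++ zs)                        ≡⟨ walkSign-++ f x ys zs ⟩
  walkSign f x ys · walkSign f y zs              ≡⟨ *-comm (walkSign f x ys) _ ⟩
  walkSign f y zs · walkSign f x ys              ≡⟨ cong (λ v → walkSign f y zs · walkSign f v ys) (sym end) ⟩
  walkSign f y zs · walkSign f (lastOf y zs) ys  ≡⟨ sym (walkSign-++ f y zs ys) ⟩
  walkSign f y (zs ++ ys)                        ∎
  where
  open ≡-Reasoning
  y = lastOf x ys
  end : lastOf y zs ≡ x
  end = trans (sym (lastOf-++ x ys zs)) closed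

walkSign-rotateTo : ∀ f x ps a ts → lastOf x (ps ++ a ∷ ts) ≡ x →
                    walkSign f x (ps ++ a ∷ ts) ≡ walkSign f a (ts ++ ps ++ a ∷ [])
walkSign-rotateTo f x ps a ts closed = begin
  walkSign f x (ps ++ a ∷ ts)                            ≡⟨ cong (walkSign f x) regroup ⟩
  walkSign f x ((ps ++ a ∷ []) ++ ts)                    ≡⟨ walkSign-rotate f x (ps ++ a ∷ []) ts
                                                              (trans (cong (lastOf x) (sym regroup)) closed) ⟩
  walkSign f (lastOf x (ps ++ a ∷ [])) (ts ++ ps ++ a ∷ []) ≡⟨ cong (λ v → walkSign f v (ts ++ ps ++ a ∷ []))
                                                                  (lastOf-snoc x ps a) ⟩
  walkSign f a (ts ++ ps ++ a ∷ [])                      ∎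
  where
  open ≡-Reasoning
  regroup : ps ++ a ∷ ts ≡ (ps ++ a ∷ []) ++ ts
  regroup = sym (++-assoc ps (a ∷ []) ts)

-- opposite s is S.- · s by definition, so the step is an instance of interchange.
walkSign-opposite : ∀ f x ys → walkSign (λ a b → opposite (f a b)) x ys ≡ signPow (length ys) · walkSign f x ys
walkSign-opposite f x []       = refl
walkSign-opposite f x (y ∷ ys) =
  trans (cong (opposite (f x y) ·_) (walkSign-opposite f y ys))
        (interchange *-commutativeSemigroup S.- (f x y) (signPow (length ys)) (walkSign f y ys))

walkSign-telescope : ∀ {R : Face → Face → Set} {P : Face → Set} f (δ : Face → Sign) →
                     (∀ {a b} → P a → P b → R a b → f a b ≡ δ a · δ b) →
                     ∀ {x} ys → Linked R (x ∷ ys) → P x → All P ys → walkSign f x ys ≡ δ x · δ (lastOf x ys)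
walkSign-telescope f δ potential {x} []       [-]     _  []         = sym (s*s≡+ (δ x))
walkSign-telescope f δ potential {x} (y ∷ ys) (r ∷ l) Px (Py ∷ Pys) = begin
  f x y · walkSign f y ys                ≡⟨ cong₂ _·_ (potential Px Py r)
                                                     (walkSign-telescope f δ potential ys l Py Pys) ⟩
  (δ x · δ y) · (δ y · δ (lastOf y ys))  ≡⟨ ·-telescope (δ x) (δ y) _ ⟩
  δ x · δ (lastOf y ys)                  ∎
  where open ≡-Reasoning

-- prefixSign f x ys j is the sign of the initial segment of x ∷ ys ending at position j of ys.
prefixSign : (Face → Face → Sign) → Face → (ys : List Face) → Fin (length ys) → Sign
prefixSign f x (y ∷ ys) zero    = f x y
prefixSign f x (y ∷ ys) (suc j) = f x y · prefixSign f y ys j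

prefixSign-step : ∀ f x ys j l → toℕ l ≡ suc (toℕ j) →
                  prefixSign f x ys l ≡ prefixSign f x ys j · f (lookup ys j) (lookup ys l)
prefixSign-step f x (y ∷ z ∷ ys) zero    (suc zero) _ = refl
prefixSign-step f x (y ∷ ys)     (suc j) (suc l)    e =
  trans (cong (f x y ·_) (prefixSign-step f y ys j l (ℕ.suc-injective e))) (sym (*-assoc (f x y) _ _))

prefixSign-last : ∀ f x ys j → suc (toℕ j) ≡ length ys → prefixSign f x ys j ≡ walkSign f x ys
prefixSign-last f x (y ∷ [])     zero    _ = sym (*-identityʳ (f x y))
prefixSign-last f x (y ∷ z ∷ ys) zero    ()
prefixSign-last f x (y ∷ ys)     (suc j) e = cong (f x y ·_) (prefixSign-last f y ys j (ℕ.suc-injective e))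

closedWalk-prefixSign : ∀ f {x} ys → lastOf x ys ≡ x → walkSign f x ys ≡ S.+ →
                        (∀ j l → f (lookup ys j) (lookup ys l) ≡ f (lookup ys l) (lookup ys j)) →
                        ∀ j l → CyclicAdj (length ys) j l →
                        f (lookup ys j) (lookup ys l) ≡ prefixSign f x ys j · prefixSign f x ys l
closedWalk-prefixSign f {x} ys@(y ∷ _) closed positive f-sym =
  CyclicAdj-elim P (λ {j} {l} p → trans (f-sym l j) (trans p (*-comm (E j) (E l)))) step wrap
  where
  E = prefixSign f x ys
  P : Fin (length ys) → Fin (length ys) → Set
  P j l = f (lookup ys j) (lookup ys l) ≡ E j · E l
  step : ∀ j l → toℕ l ≡ suc (toℕ j) → P j l
  step j l e = sym (trans (cong (E j ·_) (prefixSign-step f x ys j l e)) (·-cancelˡ (E j) _))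
  wrap : ∀ j l → suc (toℕ j) ≡ length ys → toℕ l ≡ 0 → P j l
  wrap j zero j-last _ =
    trans (cong (λ v → f v y) (trans (lookup-lastOf x ys j j-last) closed))
          (cong (_· f x y) (sym (trans (prefixSign-last f x ys j j-last) positive)))

module _ {R : Face → Face → Set} where

  Linked-++⁻ : ∀ x ys zs → Linked R (x ∷ ys ++ zs) → Linked R (x ∷ ys) × Linked R (lastOf x ys ∷ zs)
  Linked-++⁻ x []       zs l       = [-] , l
  Linked-++⁻ x (y ∷ ys) zs (r ∷ l) = let l₁ , l₂ = Linked-++⁻ y ys zs l in r ∷ l₁ , l₂

  Linked-++⁺ : ∀ x ys zs → Linked R (x ∷ ys) → Linked R (lastOf x ys ∷ zs) → Linked R (x ∷ ys ++ zs)
  Linked-++⁺ x []       zs _        l₂ = l₂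
  Linked-++⁺ x (y ∷ ys) zs (r ∷ l₁) l₂ = r ∷ Linked-++⁺ y ys zs l₁ l₂

  closedWalk-rotate : ∀ x ys zs → ClosedWalk R x (ys ++ zs) → ClosedWalk R (lastOf x ys) (zs ++ ys)
  closedWalk-rotate x ys zs (l , closed) =
    Linked-++⁺ (lastOf x ys) zs ys (proj₂ split) (subst (λ v → Linked R (v ∷ ys)) (sym end) (proj₁ split)) ,
    trans (lastOf-++ (lastOf x ys) zs ys) (cong (λ v → lastOf v ys) end)
    where
    split = Linked-++⁻ x ys zs l
    end : lastOf (lastOf x ys) zs ≡ x
    end = trans (sym (lastOf-++ x ys zs)) closed

  closedWalk-rotateTo : ∀ x ps a ts → ClosedWalk R x (ps ++ a ∷ ts) → ClosedWalk R a (ts ++ ps ++ a ∷ [])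
  closedWalk-rotateTo x ps a ts w =
    subst (λ v → ClosedWalk R v (ts ++ ps ++ a ∷ [])) (lastOf-snoc x ps a)
          (closedWalk-rotate x (ps ++ a ∷ []) ts (subst (ClosedWalk R x) (sym (++-assoc ps (a ∷ []) ts)) w))

  closedWalk-close : ∀ {x} ys → Linked R (x ∷ ys) → R (lastOf x ys) x → ClosedWalk R x (ys ++ x ∷ [])
  closedWalk-close {x} ys l r = Linked-++⁺ x ys (x ∷ []) l (r ∷ [-]) , lastOf-snoc x ys x

  Linked-lookup : ∀ {x} ys → Linked R (x ∷ ys) →
                  ∀ j l → toℕ l ≡ suc (toℕ j) → R (lookup ys j) (lookup ys l)
  Linked-lookup (y ∷ z ∷ ys) (_ ∷ r ∷ _) zero    (suc zero) _ = r
  Linked-lookup (y ∷ ys)     (_ ∷ l)     (suc j) (suc k)    e = Linked-lookup ys l j k (ℕ.suc-injective e)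

  lookup⇒Linked : ∀ ys → (∀ j l → toℕ l ≡ suc (toℕ j) → R (lookup ys j) (lookup ys l)) → Linked R ys
  lookup⇒Linked []           _    = []
  lookup⇒Linked (y ∷ [])     _    = [-]
  lookup⇒Linked (y ∷ z ∷ ys) next =
    next zero (suc zero) refl ∷ lookup⇒Linked (z ∷ ys) (λ j l e → next (suc j) (suc l) (cong suc e))

  closedWalk⇒cyclicAdj : (∀ {a b} → R a b → R b a) → ∀ {x} ys → ClosedWalk R x ys →
                         ∀ j l → CyclicAdj (length ys) j l → R (lookup ys j) (lookup ys l)
  closedWalk⇒cyclicAdj R-sym {x} ys@(y ∷ _) (l@(r ∷ _) , closed) =
    CyclicAdj-elim (λ j k → R (lookup ys j) (lookup ys k)) R-sym (Linked-lookup ys l) wrap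
    where
    wrap : ∀ j k → suc (toℕ j) ≡ length ys → toℕ k ≡ 0 → R (lookup ys j) (lookup ys k)
    wrap j zero j-last _ = subst (λ v → R v y) (sym (trans (lookup-lastOf x ys j j-last) closed)) r

  cyclicAdj⇒closedWalk : ∀ c cs →
                         (∀ j l → CyclicAdj (length (c ∷ cs)) j l → R (lookup (c ∷ cs) j) (lookup (c ∷ cs) l)) →
                         ClosedWalk R (lastOf c cs) (c ∷ cs)
  cyclicAdj⇒closedWalk c cs adj = wrap ∷ lookup⇒Linked (c ∷ cs) (λ j l e → adj j l (inj₁ e)) , refl
    where
    last≡ : suc (toℕ (fromℕ (length cs))) ≡ length (c ∷ cs)
    last≡ = cong suc (toℕ-fromℕ (length cs))
    wrap : R (lastOf c cs) c
    wrap = subst (λ v → R v c) (lookup-lastOf c (c ∷ cs) (fromℕ (length cs)) last≡)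
                 (adj (fromℕ (length cs)) zero (inj₂ (inj₂ (inj₂ (refl , last≡)))))

-- The closed walk x ∷ ps ++ a ∷ qs ++ b ∷ rs consists of the arc a ∷ arc₁ from a to b and the
-- arc b ∷ arc₂ from b back to a.
module Arcs (ps : List Face) (a : Face) (qs : List Face) (b : Face) (rs : List Face) where

  whole arc₁ arc₂ : List Face
  whole = ps ++ a ∷ qs ++ b ∷ rs
  arc₁  = qs ++ b ∷ []
  arc₂  = rs ++ ps ++ a ∷ []

  private
    split : (qs ++ b ∷ rs) ++ ps ++ a ∷ [] ≡ arc₁ ++ arc₂
    split = trans (++-assoc qs (b ∷ rs) _) (sym (++-assoc qs (b ∷ []) _))

  arc₁-end : lastOf a arc₁ ≡ b
  arc₁-end = lastOf-snoc a qs b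

  arc₂-end : lastOf b arc₂ ≡ a
  arc₂-end = trans (lastOf-++ b rs (ps ++ a ∷ [])) (lastOf-snoc _ ps a)

  closedWalk-arcs : ∀ {R : Face → Face → Set} {x} → ClosedWalk R x whole →
                    Linked R (a ∷ arc₁) × Linked R (b ∷ arc₂)
  closedWalk-arcs {R} {x} w =
    proj₁ arcs , subst (λ v → Linked R (v ∷ arc₂)) arc₁-end (proj₂ arcs)
    where
    arcs = Linked-++⁻ a arc₁ arc₂ (subst (λ vs → Linked R (a ∷ vs)) split
                                    (proj₁ (closedWalk-rotateTo x ps a (qs ++ b ∷ rs) w)))

  walkSign-arcs : ∀ f {x} → lastOf x whole ≡ x → walkSign f x whole ≡ walkSign f a arc₁ · walkSign f b arc₂
  walkSign-arcs f {x} closed = begin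
    walkSign f x whole                                  ≡⟨ walkSign-rotateTo f x ps a (qs ++ b ∷ rs) closed ⟩
    walkSign f a ((qs ++ b ∷ rs) ++ ps ++ a ∷ [])       ≡⟨ cong (walkSign f a) split ⟩
    walkSign f a (arc₁ ++ arc₂)                         ≡⟨ walkSign-++ f a arc₁ arc₂ ⟩
    walkSign f a arc₁ · walkSign f (lastOf a arc₁) arc₂ ≡⟨ cong (λ v → walkSign f a arc₁ · walkSign f v arc₂)
                                                                arc₁-end ⟩
    walkSign f a arc₁ · walkSign f b arc₂               ∎
    where open ≡-Reasoning

  arcs-length : length arc₁ + length arc₂ ≡ length whole
  arcs-length rewrite length-++ qs {b ∷ []} | length-++ rs {ps ++ a ∷ []} | length-++ ps {a ∷ []}
                    | length-++ ps {a ∷ qs ++ b ∷ rs} | length-++ qs {b ∷ rs} =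
    lengths (length ps) (length qs) (length rs)
    where
    lengths : ∀ p q r → (q + 1) + (r + (p + 1)) ≡ p + suc (q + suc r)
    lengths = solve-∀

  arc₁-shorter : ∀ {n} → n < length arc₂ → length arc₁ + n < length whole
  arc₁-shorter n<arc₂ = subst (length arc₁ + _ <_) arcs-length (ℕ.+-monoʳ-< (length arc₁) n<arc₂)

  arc₂-shorter : ∀ {n} → n < length arc₁ → length arc₂ + n < length whole
  arc₂-shorter n<arc₁ = subst (length arc₂ + _ <_) (trans (ℕ.+-comm (length arc₂) _) arcs-length)
                              (ℕ.+-monoʳ-< (length arc₂) n<arc₁)

-- Cycles in the sense of balance are closed walks without repeated vertices

cyclicSign : (Face → Face → Sign) → List Face → Sign
cyclicSign f vs = foldr (λ e s → f (proj₁ e) (proj₂ e) · s) S.+ (cyclicPairs vs)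

IsCycleOf : (Face → Face → Set) → List Face → Set
IsCycleOf R vs = (3 ≤ length vs) × Unique vs × All (λ e → R (proj₁ e) (proj₂ e)) (cyclicPairs vs)

module _ {R : Face → Face → Set} where

  Linked⇒All-zip : ∀ x ys z → Linked R (x ∷ ys ++ z ∷ []) →
                   All (λ e → R (proj₁ e) (proj₂ e)) (zip (x ∷ ys) (ys ++ z ∷ []))
  Linked⇒All-zip x []       z (r ∷ [-]) = r ∷ []
  Linked⇒All-zip x (y ∷ ys) z (r ∷ l)   = r ∷ Linked⇒All-zip y ys z l

  All-zip⇒Linked : ∀ x ys z → All (λ e → R (proj₁ e) (proj₂ e)) (zip (x ∷ ys) (ys ++ z ∷ [])) →
                   Linked R (x ∷ ys ++ z ∷ [])
  All-zip⇒Linked x []       z (r ∷ []) = r ∷ [-]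
  All-zip⇒Linked x (y ∷ ys) z (r ∷ a)  = r ∷ All-zip⇒Linked y ys z a

foldr-zip≡walkSign : ∀ f x ys z →
  foldr (λ e s → f (proj₁ e) (proj₂ e) · s) S.+ (zip (x ∷ ys) (ys ++ z ∷ [])) ≡ walkSign f x (ys ++ z ∷ [])
foldr-zip≡walkSign f x []       z = refl
foldr-zip≡walkSign f x (y ∷ ys) z = cong (f x y ·_) (foldr-zip≡walkSign f y ys z)

infix 4 _≟F_
_≟F_ : (A B : Face) → Dec (A ≡ B)
_≟F_ = ≡-dec ℕ._≟_

unique-or-repeated : ∀ ys → Unique ys ⊎
                     ∃ λ ps → ∃ λ a → ∃ λ qs → ∃ λ rs → ys ≡ ps ++ a ∷ qs ++ a ∷ rs
unique-or-repeated []       = inj₁ []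
unique-or-repeated (y ∷ ys) with Any.any? (y ≟F_) ys
... | yes y∈ys = let qs , rs , eq = ∈-∃++ y∈ys in inj₂ ([] , y , qs , rs , cong (y ∷_) eq)
... | no  y∉ys with unique-or-repeated ys
...   | inj₁ unique                  = inj₁ (¬Any⇒All¬ ys y∉ys ∷ unique)
...   | inj₂ (ps , a , qs , rs , eq) = inj₂ (y ∷ ps , a , qs , rs , cong (y ∷_) eq)

-- A repeated vertex splits a closed walk into two shorter closed walks, one of them negative if the
-- walk is; without repeated vertices a negative closed walk is a cycle.
module _ {R : Face → Face → Set} (f : Face → Face → Sign)
         (R-irrefl : ∀ {x} → ¬ R x x) (f-sym : ∀ {x y} → R x y → f x y ≡ f y x) where

  NegativeCycle : Set
  NegativeCycle = ∃ λ vs → IsCycleOf R vs × cyclicSign f vs ≡ S.-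

  unique-negative⇒cycle : ∀ {x} ys → Unique ys → ClosedWalk R x ys → walkSign f x ys ≡ S.- → NegativeCycle
  unique-negative⇒cycle []                _      _                    ()
  unique-negative⇒cycle (y ∷ [])          _      (r ∷ [-] , refl)     _        = ⊥-elim (R-irrefl r)
  unique-negative⇒cycle {x} (y ∷ _ ∷ [])  _      (r ∷ _ ∷ [-] , refl) negative =
    ⊥-elim (+≢- (trans (sym (·-cancelˡ (f y x) S.+)) (trans (cong (_· (f y x · S.+)) (sym (f-sym r))) negative)))
  unique-negative⇒cycle {x} (y ∷ vs@(_ ∷ _ ∷ _)) unique w negative =
    y ∷ vs , (s≤s (s≤s (s≤s z≤n)) , unique , Linked⇒All-zip y vs y (proj₁ (closedWalk-rotate x (y ∷ []) vs w)))
           , trans (foldr-zip≡walkSign f y vs y) (trans (sym (walkSign-rotate f x (y ∷ []) vs (proj₂ w))) negative)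

  negative-closedWalk⇒cycle : ∀ {x} ys → ClosedWalk R x ys → walkSign f x ys ≡ S.- → NegativeCycle
  negative-closedWalk⇒cycle ys = go ys (<-wellFounded (length ys))
    where
    at-repeat : ∀ {x} ps a qs rs → let ys = ps ++ a ∷ qs ++ a ∷ rs in
                (∀ {m} → m < length ys → Acc _<_ m) → ClosedWalk R x ys → walkSign f x ys ≡ S.- → NegativeCycle

    go : ∀ {x} ys → Acc _<_ (length ys) → ClosedWalk R x ys → walkSign f x ys ≡ S.- → NegativeCycle
    go ys (acc shorter) w negative with unique-or-repeated ys
    ... | inj₁ unique                     = unique-negative⇒cycle ys unique w negative
    ... | inj₂ (ps , a , qs , rs , refl) = at-repeat ps a qs rs shorter w negative

    at-repeat ps a qs rs shorter w negative =
      [ (λ negative₁ → go arc₁ (shorter arc₁<whole) (proj₁ arcs , arc₁-end) negative₁)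
      , (λ negative₂ → go arc₂ (shorter arc₂<whole) (proj₂ arcs , arc₂-end) negative₂)
      ]′ (·≡-⇒≡-⊎≡- _ _ (trans (sym (walkSign-arcs f (proj₂ w))) negative))
      where
      open Arcs ps a qs a rs
      arcs = closedWalk-arcs w
      arc₁<whole = subst (_< length whole) (ℕ.+-identityʳ _)
                         (arc₁-shorter (nonempty-++ rs _ (nonempty-++ ps _ (s≤s z≤n))))
      arc₂<whole = subst (_< length whole) (ℕ.+-identityʳ _) (arc₂-shorter (nonempty-++ qs _ (s≤s z≤n)))

-- Faces are strictly increasing lists, so a face is determined by its set of vertices

∈-drop : ∀ {y ys xs} → All (y <_) xs → All (_∈ y ∷ ys) xs → All (_∈ ys) xs
∈-drop []          []                = []
∈-drop (y<x ∷ y<s) (here refl ∷ _)   = ⊥-elim (ℕ.<-irrefl refl y<x)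
∈-drop (_   ∷ y<s) (there x∈ys ∷ ∈s) = x∈ys ∷ ∈-drop y<s ∈s

All∈⇒⊆ : ∀ {xs ys} → AllPairs _<_ xs → AllPairs _<_ ys → All (_∈ ys) xs → xs ⊆ ys
All∈⇒⊆ []          _           _                 = minimum _
All∈⇒⊆ (x<s ∷ ↗xs) (y<s ∷ ↗ys) (here refl ∷ ∈s)   = refl ∷ All∈⇒⊆ ↗xs ↗ys (∈-drop x<s ∈s)
All∈⇒⊆ (x<s ∷ ↗xs) (y<s ∷ ↗ys) (there x∈ys ∷ ∈s) =
  _ ∷ʳ All∈⇒⊆ (x<s ∷ ↗xs) ↗ys (∈-drop (y<x ∷ All.map (ℕ.<-trans y<x) x<s) (there x∈ys ∷ ∈s))
  where y<x = All.lookup y<s x∈ys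

⊆∧length≤⇒≡ : ∀ {xs ys : List ℕ} → xs ⊆ ys → length ys ≤ length xs → xs ≡ ys
⊆∧length≤⇒≡ xs⊆ys ys≤xs =
  Pointwise-≡⇒≡ (toPointwise (ℕ.≤-antisym (length-mono-≤ xs⊆ys) ys≤xs) xs⊆ys)

∈-∩⁺ : ∀ {A B z} → z ∈ A → z ∈ B → z ∈ A ∩ B
∈-∩⁺ {A} {B} = ∈-filter⁺ (_∈? B)

∈-∩⁻ : ∀ A B {z} → z ∈ A ∩ B → z ∈ A × z ∈ B
∈-∩⁻ A B = ∈-filter⁻ (_∈? B)

∩-increasing : ∀ {A} B → AllPairs _<_ A → AllPairs _<_ (A ∩ B)
∩-increasing B = AllPairs.filter⁺ (_∈? B)

∩-comm : ∀ {A B} → AllPairs _<_ A → AllPairs _<_ B → A ∩ B ≡ B ∩ A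
∩-comm ↗A ↗B = ⊆-antisym (swap ↗A ↗B) (swap ↗B ↗A)
  where
  swap : ∀ {X Y} → AllPairs _<_ X → AllPairs _<_ Y → X ∩ Y ⊆ Y ∩ X
  swap {X} {Y} ↗X ↗Y = All∈⇒⊆ (∩-increasing Y ↗X) (∩-increasing X ↗Y)
    (All.tabulate λ z∈ → let z∈X , z∈Y = ∈-∩⁻ X Y z∈ in ∈-∩⁺ z∈Y z∈X)

∩-idem : ∀ A → A ∩ A ≡ A
∩-idem A = filter-all (_∈? A) (All.tabulate id)

∩-codim₁ : ∀ {G A B} → AllPairs _<_ G → AllPairs _<_ A → AllPairs _<_ B →
           All (_∈ A) G → All (_∈ B) G → A ≢ B →
           length A ≡ suc (length G) → length B ≡ length A → A ∩ B ≡ G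
∩-codim₁ {G} {A} {B} ↗G ↗A ↗B G⊆A G⊆B A≢B |A| |B| =
  sym (⊆∧length≤⇒≡ (All∈⇒⊆ ↗G (∩-increasing B ↗A) (All.zipWith (uncurry ∈-∩⁺) (G⊆A , G⊆B)))
                   (ℕ.≤-pred (subst (length (A ∩ B) <_) |A| A∩B<A)))
  where
  A⊈B : ¬ All (_∈ B) A
  A⊈B A⊆B = A≢B (⊆∧length≤⇒≡ (All∈⇒⊆ ↗A ↗B A⊆B) (ℕ.≤-reflexive |B|))
  A∩B<A : length (A ∩ B) < length A
  A∩B<A = filter-notAll (_∈? B) A (¬All⇒Any¬ (_∈? B) A A⊈B)

-- The dual graph of the (i+1)-faces of K

n<ᵇ1+n : ∀ n → (n <ᵇ suc n) ≡ true
n<ᵇ1+n zero    = refl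
n<ᵇ1+n (suc n) = n<ᵇ1+n n

1+n<ᵇn : ∀ n → (suc n <ᵇ n) ≡ false
1+n<ᵇn zero    = refl
1+n<ᵇn (suc n) = 1+n<ᵇn n

module DualGraph (i : ℕ) (K : SimplicialComplex) where

  Ridge Facet : Face → Set
  Ridge = IsFace K i
  Facet = IsFace K (suc i)

  infix 4 _~_
  _~_ : Face → Face → Set
  A ~ B = Facet A × Facet B × MeetInIFace i A B

  face-increasing : ∀ {n F} → IsFace K n F → AllPairs _<_ F
  face-increasing (F∈K , _) = Linked⇒AllPairs ℕ.<-trans (All.lookup (facesSorted K) F∈K)

  ridge≢facet : ∀ {F} → Ridge F → ¬ Facet F
  ridge≢facet (_ , |F|≡1+i) (_ , |F|≡2+i) = ℕ.1+n≢n (sym (trans (sym |F|≡1+i) |F|≡2+i))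

  ~-irrefl : ∀ {A} → ¬ A ~ A
  ~-irrefl {A} (A-facet , _ , A∩A-ridge) =
    ridge≢facet (proj₁ A-facet , subst (λ F → length F ≡ suc i) (∩-idem A) A∩A-ridge) A-facet

  ~-sym : ∀ {A B} → A ~ B → B ~ A
  ~-sym (A-facet , B-facet , meet) =
    B-facet , A-facet , trans (cong length (∩-comm (face-increasing B-facet) (face-increasing A-facet))) meet

  ~⇒incidences : ∀ {A B} → A ~ B → Incidence K i (A ∩ B) A × Incidence K i (A ∩ B) B
  ~⇒incidences {A} {B} (A-facet , B-facet , meet) =
    (A∩B-ridge , A-facet , All.tabulate (proj₁ ∘ ∈-∩⁻ A B)) ,
    (A∩B-ridge , B-facet , All.tabulate (proj₂ ∘ ∈-∩⁻ A B))
    where A∩B-ridge = downClosed K (proj₁ A-facet) (filter-⊆ (_∈? B) A) , meet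

  incidences⇒~ : ∀ {G A B} → Incidence K i G A → Incidence K i G B → A ≢ B → A ∩ B ≡ G × A ~ B
  incidences⇒~ (G-ridge , A-facet , G⊆A) (_ , B-facet , G⊆B) A≢B =
    A∩B≡G , A-facet , B-facet , trans (cong length A∩B≡G) (proj₂ G-ridge)
    where
    A∩B≡G = ∩-codim₁ (face-increasing G-ridge) (face-increasing A-facet) (face-increasing B-facet) G⊆A G⊆B A≢B
                     (trans (proj₂ A-facet) (cong suc (sym (proj₂ G-ridge))))
                     (trans (proj₂ B-facet) (sym (proj₂ A-facet)))

  Adj-irrefl : ∀ {u} → ¬ Adj K i u u
  Adj-irrefl (inj₁ (u-ridge , u-facet , _)) = ridge≢facet u-ridge u-facet
  Adj-irrefl (inj₂ (u-ridge , u-facet , _)) = ridge≢facet u-ridge u-facet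

  Adj-from-facet : ∀ {A v} → Facet A → Adj K i A v → Incidence K i v A
  Adj-from-facet A-facet (inj₁ (A-ridge , _)) = ⊥-elim (ridge≢facet A-ridge A-facet)
  Adj-from-facet A-facet (inj₂ inc)           = inc

  Adj²-from-facet : ∀ {A G B} → Facet A → Adj K i A G → Adj K i G B → Incidence K i G A × Incidence K i G B
  Adj²-from-facet A-facet AG (inj₁ GB) = Adj-from-facet A-facet AG , GB
  Adj²-from-facet A-facet AG (inj₂ (_ , G-facet , _)) =
    ⊥-elim (ridge≢facet (proj₁ (Adj-from-facet A-facet AG)) G-facet)

  walk-facets : ∀ {x} ys → Linked _~_ (x ∷ ys) → All Facet ys
  walk-facets []       [-]       = []
  walk-facets (y ∷ ys) (x~y ∷ l) = proj₁ (proj₂ x~y) ∷ walk-facets ys l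

  meet⇒~ : ∀ {cs} → All Facet cs →
           ∀ j l → MeetInIFace i (lookup cs j) (lookup cs l) → lookup cs j ~ lookup cs l
  meet⇒~ facets j l meet = All.lookup facets (∈-lookup j) , All.lookup facets (∈-lookup l) , meet

  Chordless : List Face → Set
  Chordless cs = ∀ j l → MeetInIFace i (lookup cs j) (lookup cs l) → CyclicAdj (length cs) j l

  chord? : ∀ cs → Dec (∃ λ j → ∃ λ l → MeetInIFace i (lookup cs j) (lookup cs l) × ¬ CyclicAdj (length cs) j l)
  chord? cs = any? λ j → any? λ l →
    length (lookup cs j ∩ lookup cs l) ℕ.≟ suc i ×-dec ¬? (CyclicAdj? _ j l)

  closedWalk⇒circuit : ∀ {x} cs → ClosedWalk _~_ x cs → Chordless cs → IsCircuit K i cs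
  closedWalk⇒circuit cs w chordless =
    walk-facets cs (proj₁ w) ,
    λ j l → mk⇔ (chordless j l) (proj₂ ∘ proj₂ ∘ closedWalk⇒cyclicAdj ~-sym cs w j l)

  circuit⇒closedWalk : ∀ c cs → IsCircuit K i (c ∷ cs) →
                       ClosedWalk _~_ (lastOf c cs) (c ∷ cs) × Chordless (c ∷ cs)
  circuit⇒closedWalk c cs (facets , meet⇔adj) =
    cyclicAdj⇒closedWalk c cs (λ j l adj → meet⇒~ facets j l (Equivalence.from (meet⇔adj j l) adj)) ,
    λ j l → Equivalence.to (meet⇔adj j l)

  module Oriented (o : Orientation) where

    dualSign : Face → Face → Sign
    dualSign A B = sgn o (A ∩ B) A · sgn o (A ∩ B) B

    dualSign-sym : ∀ {A B} → Facet A → Facet B → dualSign A B ≡ dualSign B A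
    dualSign-sym {A} {B} A-facet B-facet rewrite ∩-comm (face-increasing A-facet) (face-increasing B-facet) =
      *-comm (sgn o (B ∩ A) A) (sgn o (B ∩ A) B)

    edgeSign-incidence : ∀ {G A} → Incidence K i G A → edgeSign o G A ≡ sgn o G A × edgeSign o A G ≡ sgn o G A
    edgeSign-incidence ((_ , |G|) , (_ , |A|) , _) rewrite |G| | |A| | n<ᵇ1+n i | 1+n<ᵇn i = refl , refl

    edgeSign-Adj-sym : ∀ {u v} → Adj K i u v → edgeSign o u v ≡ edgeSign o v u
    edgeSign-Adj-sym (inj₁ inc) = let p , q = edgeSign-incidence inc in trans p (sym q)
    edgeSign-Adj-sym (inj₂ inc) = let p , q = edgeSign-incidence inc in trans q (sym p)

    edgeSign-path : ∀ {G A B} → Incidence K i G A → Incidence K i G B →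
                    edgeSign o A G · edgeSign o G B ≡ sgn o G A · sgn o G B
    edgeSign-path GA GB = cong₂ _·_ (proj₂ (edgeSign-incidence GA)) (proj₁ (edgeSign-incidence GB))

    ridge-step : ∀ {G A B} → Incidence K i G A → Incidence K i G B →
                 (A ≡ B × edgeSign o A G · edgeSign o G B ≡ S.+) ⊎
                 (A ~ B × edgeSign o A G · edgeSign o G B ≡ dualSign A B)
    ridge-step {G} {A} {B} GA GB with A ≟F B
    ... | yes refl = inj₁ (refl , trans (edgeSign-path GA GB) (s*s≡+ (sgn o G A)))
    ... | no  A≢B  = let A∩B≡G , A~B = incidences⇒~ GA GB A≢B in
      inj₂ (A~B , trans (edgeSign-path GA GB) (cong (λ H → sgn o H A · sgn o H B) (sym A∩B≡G)))

    dual⇒B-walk : ∀ {x} ys → Linked _~_ (x ∷ ys) →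
                  ∃ λ bs → Linked (Adj K i) (x ∷ bs) × lastOf x bs ≡ lastOf x ys
                         × walkSign (edgeSign o) x bs ≡ walkSign dualSign x ys
    dual⇒B-walk []           [-]       = [] , [-] , refl , refl
    dual⇒B-walk {x} (y ∷ ys) (x~y ∷ l) with dual⇒B-walk ys l | ~⇒incidences x~y
    ... | bs , l′ , end , sign | Gx , Gy =
      x ∩ y ∷ y ∷ bs , inj₂ Gx ∷ inj₁ Gy ∷ l′ , end ,
      trans (sym (*-assoc (edgeSign o x (x ∩ y)) (edgeSign o (x ∩ y) y) _)) (cong₂ _·_ (edgeSign-path Gx Gy) sign)

    B-walk⇒dual : ∀ {x} bs → Facet x → Facet (lastOf x bs) → Linked (Adj K i) (x ∷ bs) →
                  ∃ λ ys → Linked _~_ (x ∷ ys) × lastOf x ys ≡ lastOf x bs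
                         × walkSign (edgeSign o) x bs ≡ walkSign dualSign x ys
    B-walk⇒dual []           _       _          [-]        = [] , [-] , refl , refl
    B-walk⇒dual (G ∷ [])     x-facet G-facet    (xG ∷ [-]) =
      ⊥-elim (ridge≢facet (proj₁ (Adj-from-facet x-facet xG)) G-facet)
    B-walk⇒dual {x} (G ∷ y ∷ bs) x-facet end-facet (xG ∷ Gy ∷ l)
      with Gx , Gy′ ← Adj²-from-facet x-facet xG Gy
      with B-walk⇒dual bs (proj₁ (proj₂ Gy′)) end-facet l | ridge-step Gx Gy′
    ... | ys , l′ , end , sign | inj₁ (refl , back) =
      ys , l′ , end , trans (sym (*-assoc (edgeSign o x G) (edgeSign o G x) _)) (trans (cong (_· _) back) sign)
    ... | ys , l′ , end , sign | inj₂ (x~y , cross) =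
      y ∷ ys , x~y ∷ l′ , end , trans (sym (*-assoc (edgeSign o x G) (edgeSign o G y) _)) (cong₂ _·_ cross sign)

    ClosedDualWalksPositive : Set
    ClosedDualWalksPositive = ∀ x ys → ClosedWalk _~_ x ys → walkSign dualSign x ys ≡ S.+

    balanced⇒closedDualWalksPositive : Balanced K i o → ClosedDualWalksPositive
    balanced⇒closedDualWalksPositive balanced x ys (l , closed) = ≢-⇒≡+ λ negative →
      let bs , l′ , end , sign = dual⇒B-walk ys l
          vs , cycle , cycle-negative = negative-closedWalk⇒cycle (edgeSign o) Adj-irrefl edgeSign-Adj-sym
                                          bs (l′ , trans end closed) (trans sign negative)
      in +≢- (trans (sym (balanced vs cycle)) cycle-negative)

    closedDualWalksPositive⇒balanced : ClosedDualWalksPositive → Balanced K i o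
    closedDualWalksPositive⇒balanced positive (v ∷ vs) (_ , _ , adjacent) =
      trans (foldr-zip≡walkSign (edgeSign o) v vs v)
            (closed-B-walk-positive (vs ++ v ∷ []) (All-zip⇒Linked v vs v adjacent , lastOf-snoc v vs v))
      where
      from-facet : ∀ {x} bs → Facet x → ClosedWalk (Adj K i) x bs → walkSign (edgeSign o) x bs ≡ S.+
      from-facet {x} bs x-facet (l , closed) =
        let ys , l′ , end , sign = B-walk⇒dual bs x-facet (subst Facet (sym closed) x-facet) l
        in trans sign (positive x ys (l′ , trans end closed))

      -- a closed walk starting at an i-face is first rotated to start at the (i+1)-face after it
      closed-B-walk-positive : ∀ {x} bs → ClosedWalk (Adj K i) x bs → walkSign (edgeSign o) x bs ≡ S.+
      closed-B-walk-positive []       _                     = refl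
      closed-B-walk-positive (b ∷ bs) w@(inj₂ bx ∷ _ , _)  = from-facet (b ∷ bs) (proj₁ (proj₂ bx)) w
      closed-B-walk-positive {x} (b ∷ bs) w@(inj₁ xb ∷ _ , closed) =
        trans (walkSign-rotate (edgeSign o) x (b ∷ []) bs closed)
              (from-facet (bs ++ b ∷ []) (proj₁ (proj₂ xb)) (closedWalk-rotate x (b ∷ []) bs w))

    balanced⇔closedDualWalksPositive : Balanced K i o ⇔ ClosedDualWalksPositive
    balanced⇔closedDualWalksPositive = mk⇔ balanced⇒closedDualWalksPositive closedDualWalksPositive⇒balanced

    CircuitsPositive : Set
    CircuitsPositive = ∀ x cs → ClosedWalk _~_ x cs → Chordless cs → walkSign dualSign x cs ≡ S.+

    chord-split : ∀ {x} ps a qs b rs → ClosedWalk _~_ x (ps ++ a ∷ qs ++ b ∷ rs) → a ~ b →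
                  1 < length (qs ++ b ∷ []) → 1 < length (rs ++ ps ++ a ∷ []) →
                  (∀ {y} zs → length zs < length (ps ++ a ∷ qs ++ b ∷ rs) → ClosedWalk _~_ y zs →
                     walkSign dualSign y zs ≡ S.+) →
                  walkSign dualSign x (ps ++ a ∷ qs ++ b ∷ rs) ≡ S.+
    chord-split ps a qs b rs w a~b long₁ long₂ shorter-positive =
      trans (walkSign-arcs dualSign (proj₂ w))
            (·≡+-common (walkSign dualSign a arc₁) (walkSign dualSign b arc₂) (dualSign a b · S.+)
              (trans (cong (λ s → walkSign dualSign a arc₁ · (s · S.+)) (dualSign-sym a-facet b-facet))
                     (trans (sym sign₁) (shorter-positive (arc₁ ++ a ∷ []) shorter₁ walk₁)))
              (trans (sym sign₂) (shorter-positive (arc₂ ++ b ∷ []) shorter₂ walk₂)))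
      where
      open Arcs ps a qs b rs
      a-facet = proj₁ a~b
      b-facet = proj₁ (proj₂ a~b)
      walk₁ : ClosedWalk _~_ a (arc₁ ++ a ∷ [])
      walk₁ = closedWalk-close arc₁ (proj₁ (closedWalk-arcs w)) (subst (_~ a) (sym arc₁-end) (~-sym a~b))
      walk₂ : ClosedWalk _~_ b (arc₂ ++ b ∷ [])
      walk₂ = closedWalk-close arc₂ (proj₂ (closedWalk-arcs w)) (subst (_~ b) (sym arc₂-end) a~b)
      shorter₁ = subst (_< length whole) (sym (length-++ arc₁)) (arc₁-shorter long₂)
      shorter₂ = subst (_< length whole) (sym (length-++ arc₂)) (arc₂-shorter long₁)
      sign₁ : walkSign dualSign a (arc₁ ++ a ∷ []) ≡ walkSign dualSign a arc₁ · (dualSign b a · S.+)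
      sign₁ = trans (walkSign-++ dualSign a arc₁ (a ∷ []))
                    (cong (λ v → walkSign dualSign a arc₁ · (dualSign v a · S.+)) arc₁-end)
      sign₂ : walkSign dualSign b (arc₂ ++ b ∷ []) ≡ walkSign dualSign b arc₂ · (dualSign a b · S.+)
      sign₂ = trans (walkSign-++ dualSign b arc₂ (b ∷ []))
                    (cong (λ v → walkSign dualSign b arc₂ · (dualSign v b · S.+)) arc₂-end)

    closedDualWalksPositive⇔circuitsPositive : ClosedDualWalksPositive ⇔ CircuitsPositive
    closedDualWalksPositive⇔circuitsPositive =
      mk⇔ (λ positive x cs w _ → positive x cs w) (λ positive x ys → go positive x ys (<-wellFounded (length ys)))
      where
      along-chord : CircuitsPositive → ∀ {x} ys → (∀ {m} → m < length ys → Acc _<_ m) → ClosedWalk _~_ x ys →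
                    ∀ j l → toℕ j < toℕ l → lookup ys j ~ lookup ys l → ¬ CyclicAdj (length ys) j l →
                    walkSign dualSign x ys ≡ S.+

      go : CircuitsPositive → ∀ x ys → Acc _<_ (length ys) → ClosedWalk _~_ x ys → walkSign dualSign x ys ≡ S.+
      go positive x ys (acc shorter) w with chord? ys
      ... | no no-chord = positive x ys w λ j l meet →
            decidable-stable (CyclicAdj? _ j l) (λ ¬adj → no-chord (j , l , meet , ¬adj))
      ... | yes (j , l , meet , ¬adj) with ℕ.<-cmp (toℕ j) (toℕ l) | meet⇒~ (walk-facets ys (proj₁ w)) j l meet
      ...   | tri< j<l _ _ | j~l = along-chord positive ys shorter w j l j<l j~l ¬adj
      ...   | tri≈ _ j≡l _ | j~l =
        ⊥-elim (~-irrefl (subst (λ k → lookup ys j ~ lookup ys k) (sym (toℕ-injective j≡l)) j~l))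
      ...   | tri> _ _ l<j | j~l = along-chord positive ys shorter w l j l<j (~-sym j~l) (¬adj ∘ CyclicAdj-sym)

      along-chord positive ys shorter w j l j<l j~l ¬adj with split-at₂ ys j l j<l
      ... | ps , a , qs , b , rs , refl , ja , lb , |ps| , l≡ =
        chord-split ps a qs b rs w (subst₂ _~_ ja lb j~l)
          (chord-arc₁ ps qs b |ps| l≡ (¬adj ∘ inj₁))
          (chord-arc₂ ps a qs b rs |ps| l≡ refl (¬adj ∘ inj₂ ∘ inj₂ ∘ inj₁))
          (λ zs smaller → go positive _ zs (shorter smaller))

    -- With ε = δ · ori o, compatibility of ε along A ~ B says dualSign A B ≡ opposite (δ A · δ B).

    dualSign≡induced : ∀ A B → dualSign A B ≡ induced (ori o) A (A ∩ B) · induced (ori o) B (A ∩ B)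
    dualSign≡induced A B = begin
      sgn o G A · sgn o G B            ≡⟨ cong₂ _·_ (sym (*-assoc (signPow (removedIndex G A)) _ _))
                                                    (sym (*-assoc (signPow (removedIndex G B)) _ _)) ⟩
      (iA · ori o G) · (iB · ori o G)  ≡⟨ interchange *-commutativeSemigroup iA (ori o G) iB (ori o G) ⟩
      (iA · iB) · (ori o G · ori o G)  ≡⟨ cong ((iA · iB) ·_) (s*s≡+ (ori o G)) ⟩
      (iA · iB) · S.+                  ≡⟨ *-identityʳ (iA · iB) ⟩
      iA · iB                          ∎
      where
      open ≡-Reasoning
      G = A ∩ B
      iA = induced (ori o) A G
      iB = induced (ori o) B G

    induced-relative : ∀ (ε δ : Face → Sign) A G → ε A ≡ δ A · ori o A →
                       induced ε A G ≡ induced (ori o) A G · δ A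
    induced-relative ε δ A G εA = begin
      signPow r · ε A              ≡⟨ cong (signPow r ·_) (trans εA (*-comm (δ A) (ori o A))) ⟩
      signPow r · (ori o A · δ A)  ≡⟨ sym (*-assoc (signPow r) (ori o A) (δ A)) ⟩
      (signPow r · ori o A) · δ A  ∎
      where
      open ≡-Reasoning
      r = removedIndex G A

    opposite-induced⇔ : ∀ (ε δ : Face → Sign) {A B} → ε A ≡ δ A · ori o A → ε B ≡ δ B · ori o B →
      induced ε A (A ∩ B) ≡ opposite (induced ε B (A ∩ B)) ⇔ dualSign A B ≡ opposite (δ A · δ B)
    opposite-induced⇔ ε δ {A} {B} εA εB = mk⇔
      (λ eq → trans (dualSign≡induced A B)
                    (opposite-swap iA iB (δ A) (δ B) (subst₂ (λ u v → u ≡ opposite v) relA relB eq)))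
      (λ eq → subst₂ (λ u v → u ≡ opposite v) (sym relA) (sym relB)
                     (opposite-swap iA (δ A) iB (δ B) (trans (sym (dualSign≡induced A B)) eq)))
      where
      iA = induced (ori o) A (A ∩ B)
      iB = induced (ori o) B (A ∩ B)
      relA = induced-relative ε δ A (A ∩ B) εA
      relB = induced-relative ε δ B (A ∩ B) εB

    oppositeDualSign : Face → Face → Sign
    oppositeDualSign A B = opposite (dualSign A B)

    orientable⇒oppositeDualSign-positive : ∀ {x} cs → ClosedWalk _~_ x cs → Orientable i cs →
                                           walkSign oppositeDualSign x cs ≡ S.+
    orientable⇒oppositeDualSign-positive []            _            _              = refl
    orientable⇒oppositeDualSign-positive {x} cs@(c ∷ cs′) (l , closed) (ε , compatible) = begin
      walkSign oppositeDualSign x cs  ≡⟨ walkSign-telescope oppositeDualSign δ potential cs l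
                                                            x∈cs (All.tabulate id) ⟩
      δ x · δ (lastOf x cs)           ≡⟨ cong (λ v → δ x · δ v) closed ⟩
      δ x · δ x                       ≡⟨ s*s≡+ (δ x) ⟩
      S.+                             ∎
      where
      open ≡-Reasoning
      δ : Face → Sign
      δ X = ε X · ori o X
      ε≡δ·ori : ∀ X → ε X ≡ δ X · ori o X
      ε≡δ·ori X = sym (trans (*-assoc (ε X) _ _) (trans (cong (ε X ·_) (s*s≡+ (ori o X))) (*-identityʳ (ε X))))
      potential : ∀ {a b} → a ∈ cs → b ∈ cs → a ~ b → oppositeDualSign a b ≡ δ a · δ b
      potential {a} {b} a∈cs b∈cs a~b =
        Equivalence.to (≡opposite⇔opposite≡ {dualSign a b} {δ a · δ b})
          (Equivalence.to (opposite-induced⇔ ε δ (ε≡δ·ori a) (ε≡δ·ori b))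
            (compatible a∈cs b∈cs (λ { refl → ~-irrefl a~b }) (proj₂ (proj₂ a~b))))
      x∈cs : x ∈ cs
      x∈cs = subst (_∈ cs) closed (lastOf-∈ x c cs′)

    oppositeDualSign-positive⇒orientable : ∀ {x} cs → ClosedWalk _~_ x cs → Chordless cs →
                                           walkSign oppositeDualSign x cs ≡ S.+ → Orientable i cs
    oppositeDualSign-positive⇒orientable {x} cs (l , closed) chordless positive = ε , compatible
      where
      E = prefixSign oppositeDualSign x cs
      facet-at : ∀ j → Facet (lookup cs j)
      facet-at j = All.lookup (walk-facets cs l) (∈-lookup j)
      -- every facet of the circuit is labelled by the prefix sign at its first position
      δ : Face → Sign
      δ X with Any.any? (X ≟F_) cs
      ... | yes X∈cs = E (index X∈cs)
      ... | no  _    = S.+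
      δ-at : ∀ {X} → X ∈ cs → ∃ λ j → lookup cs j ≡ X × δ X ≡ E j
      δ-at {X} X∈cs with Any.any? (X ≟F_) cs
      ... | yes X∈cs′ = index X∈cs′ , sym (lookup-index X∈cs′) , refl
      ... | no  X∉cs  = ⊥-elim (X∉cs X∈cs)
      ε : Face → Sign
      ε X = δ X · ori o X
      compatible : ∀ {A B} → A ∈ cs → B ∈ cs → A ≢ B → MeetInIFace i A B →
                   induced ε A (A ∩ B) ≡ opposite (induced ε B (A ∩ B))
      compatible A∈cs B∈cs _ meet with δ-at A∈cs | δ-at B∈cs
      ... | j , refl , δA | l , refl , δB =
        Equivalence.from (opposite-induced⇔ ε δ {lookup cs j} {lookup cs l} refl refl)
          (Equivalence.from (≡opposite⇔opposite≡ {dualSign A B} {δ A · δ B})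
            (trans (closedWalk-prefixSign oppositeDualSign cs closed positive oppositeDualSign-sym
                                          j l (chordless j l meet))
                   (sym (cong₂ _·_ δA δB))))
        where
        A = lookup cs j
        B = lookup cs l
        oppositeDualSign-sym : ∀ j l → oppositeDualSign (lookup cs j) (lookup cs l)
                                     ≡ oppositeDualSign (lookup cs l) (lookup cs j)
        oppositeDualSign-sym j l = cong opposite (dualSign-sym (facet-at j) (facet-at l))

    circuit-orientable⇔ : ∀ {x} cs → ClosedWalk _~_ x cs → Chordless cs →
                          Orientable i cs ⇔ signPow (length cs) ≡ walkSign dualSign x cs
    circuit-orientable⇔ {x} cs w chordless = mk⇔
      (λ orientable → Equivalence.to (·≡+⇔≡ _ _)
         (trans (sym (walkSign-opposite dualSign x cs)) (orientable⇒oppositeDualSign-positive cs w orientable)))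
      (λ eq → oppositeDualSign-positive⇒orientable cs w chordless
         (trans (walkSign-opposite dualSign x cs) (Equivalence.from (·≡+⇔≡ _ _) eq)))

    circuitsPositive⇔noBadCircuits : CircuitsPositive ⇔ NoBadCircuits K i
    circuitsPositive⇔noBadCircuits = mk⇔ noBadCircuits circuitsPositive
      where
      noBadCircuits : CircuitsPositive → NoBadCircuits K i
      noBadCircuits positive = odd-orientable , even-nonorientable
        where
        odd-orientable : ¬ (∃ λ cs → IsCircuit K i cs × Orientable i cs × Odd (length cs))
        odd-orientable (c ∷ cs , circuit , orientable , odd)
          with w , chordless ← circuit⇒closedWalk c cs circuit
          with signPow-parity (length (c ∷ cs))
        ... | inj₁ (even , _)  = 0≢1 (trans (sym even) odd)
        ... | inj₂ (_ , pow≡-) =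
          +≢- (trans (sym (positive _ _ w chordless))
                     (trans (sym (Equivalence.to (circuit-orientable⇔ _ w chordless) orientable)) pow≡-))
        even-nonorientable : ¬ (∃ λ cs → IsCircuit K i cs × ¬ Orientable i cs × Even (length cs))
        even-nonorientable ([] , _ , nonorientable , _) = nonorientable ((λ _ → S.+) , λ ())
        even-nonorientable (c ∷ cs , circuit , nonorientable , even)
          with w , chordless ← circuit⇒closedWalk c cs circuit
          with signPow-parity (length (c ∷ cs))
        ... | inj₂ (odd , _)   = 0≢1 (trans (sym even) odd)
        ... | inj₁ (_ , pow≡+) = nonorientable (Equivalence.from (circuit-orientable⇔ _ w chordless)
                                                  (trans pow≡+ (sym (positive _ _ w chordless))))
      circuitsPositive : NoBadCircuits K i → CircuitsPositive
      circuitsPositive (no-odd-orientable , no-even-nonorientable) x cs w chordless = ≢-⇒≡+ λ negative →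
        let circuit = closedWalk⇒circuit cs w chordless
            orientable⇔ = circuit-orientable⇔ cs w chordless
        in case signPow-parity (length cs) of λ where
             (inj₁ (even , pow≡+)) → no-even-nonorientable
               (cs , circuit , (λ orientable → +≢- (trans (sym pow≡+) (trans (Equivalence.to orientable⇔ orientable) negative)))
                  , even)
             (inj₂ (odd , pow≡-))  → no-odd-orientable
               (cs , circuit , Equivalence.from orientable⇔ (trans pow≡- (sym negative)) , odd)

theorem3p4 : (i : ℕ) (K : SimplicialComplex) → PathConnected K i →
    (o : Orientation) → Balanced K i o ⇔ NoBadCircuits K i
theorem3p4 i K _ o =
  ⇔-trans balanced⇔closedDualWalksPositive
          (⇔-trans closedDualWalksPositive⇔circuitsPositive circuitsPositive⇔noBadCircuits)
  where
  open DualGraph i K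
  open Oriented o
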